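{- Let $G$ be a graph, let $F$ be a complete-factor of $G$ with $\omega(F)\geq 2$, and let $g,f:V(G)\rightarrow \mathbb{Z}^{+}$ be two integer-valued functions with $g(x)\leq f(x)$ for any $x\in V(G)$. Let $H$ be a subgraph of $G$. If $G-V(C)$ has all fractional $(g,f)$-factors excluding $H$ for each component $C$ of $F$, then $G$ itself has all fractional $(g,f)$-factors excluding $H$.
   Context: Graphs are finite, undirected, without loops or multiple edges. $\mathbb{Z}^{+}$ is the set of positive integers. $\omega(F)$ is the number of connected components of $F$. $G-X$ is the subgraph of $G$ induced by $V(G)\setminus X$. A complete-factor of $G$ is a spanning subgraph $F$ of $G$ each of whose components is isomorphic to a complete graph $K_n$ for some $n\ge 1$ (possibly different $n$ for different components). For a graph $G'$ and $r:V(G')\to\mathbb{Z}^{+}$, a function $h:E(G')\to[0,1]$ with $\sum_{e\in E(x)}h(e)=r(x)$ for every $x\in V(G')$, where $E(x)$ is the set of edges of $G'$ incident with $x$, determines a fractional $r$-factor $F_h$ of $G'$: the subgraph with vertex set $V(G')$ and edge set $E(F_h)=\{e\in E(G'):h(e)>0\}$. $G'$ has all fractional $(g,f)$-factors excluding $H$ if for every $r:V(G')\to\mathbb{Z}^{+}$ with $g(x)\le r(x)\le f(x)$ for all $x\in V(G')$, $G'$ has a fractional $r$-factor $F_h$ with $E(H)\cap E(F_h)=\emptyset$. For $G'=G-V(C)$, the functions $g,f$ are restricted to $V(G')$, and the condition $E(H)\cap E(F_h)=\emptyset$ is used verbatim even if $H$ is not contained in $G'$. -}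

module Defs where

open import Algebra.Bundles.Raw using (RawMonoid)
import Algebra.Definitions.RawMonoid as RawMonoidDefs
open import Data.Bool.Properties as Bool using ()
open import Data.Fin.Base using (Fin; toℕ)
open import Data.Fin.Properties as Fin using (toℕ<n; toℕ-injective)
open import Data.Fin.Subset using (Subset; _∈_; _⊆_; _∩_; _─_; ⊤)
open import Data.Fin.Subset.Properties using (_∈?_; p∩q⊆p; x∈p∩q⁺; ∈⊤)
open import Data.Integer.Base using (+_)
open import Data.List.Base using (List; map; filter; length; allFin; deduplicate)
open import Data.List.Membership.Propositional using () renaming (_∈_ to _∈ˡ_)
open import Data.Nat.Base using (ℕ; zero; suc; _≤_; _<_; _≥_; _⊔_)
import Data.Nat.Properties as ℕ
open import Data.Product.Base using (Σ; ∃; _×_; _,_; proj₁; proj₂)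
open import Data.Rational.Base as ℚ using (ℚ; 0ℚ; 1ℚ; ½)
import Data.Rational.Properties as ℚ
open import Data.Rational.Solver using (module +-*-Solver)
open import Data.Refinement using (Refinement-syntax; value; refine)
open import Data.Sum.Base using (_⊎_; inj₁; inj₂; [_,_]′)
open import Data.Vec.Base using (tabulate)
import Data.Vec.Properties as Vec
open import Function.Base using (_∘_; const)
open import Function.Bundles using (_⇔_; _↔_; Inverse)
open import Level using (0ℓ)
open import Relation.Binary.Core using (Rel; _⇒_)
open import Relation.Binary.Definitions using (Decidable; Symmetric; Irreflexive; tri<; tri≈; tri>)
open import Relation.Binary.Construct.Closure.ReflexiveTransitive using (Star; ε; _◅_; _◅◅_)
open import Relation.Binary.PropositionalEquality using (_≡_; _≢_; refl; sym; trans; cong; subst)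
open import Relation.Nullary.Decidable using (does; map′; toSum; ¬?; _×-dec_; _⊎-dec_)
open import Relation.Nullary.Negation using (¬_)

------------------------------------------------------------------------
-- Real numbers: Cauchy sequences of rationals with setoid equality

Eventually : (ℕ → Set) → Set
Eventually P = ∃ λ M → ∀ n → n ≥ M → P n

record ℝ : Set where
  field
    seq    : ℕ → ℚ
    cauchy : ∀ δ → 0ℚ ℚ.< δ →
             ∃ λ M → ∀ m n → m ≥ M → n ≥ M → ℚ.∣ seq m ℚ.- seq n ∣ ℚ.< δ

open ℝ public

infix 4 _≈ℝ_ _≤ℝ_ _<ℝ_
infixl 6 _+ℝ_

_≈ℝ_ : Rel ℝ 0ℓ
x ≈ℝ y = ∀ δ → 0ℚ ℚ.< δ → Eventually λ n → ℚ.∣ seq x n ℚ.- seq y n ∣ ℚ.< δ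

_≤ℝ_ : Rel ℝ 0ℓ
x ≤ℝ y = ∀ δ → 0ℚ ℚ.< δ → Eventually λ n → seq x n ℚ.< seq y n ℚ.+ δ

_<ℝ_ : Rel ℝ 0ℓ
x <ℝ y = ∃ λ δ → 0ℚ ℚ.< δ × Eventually λ n → seq x n ℚ.+ δ ℚ.< seq y n

fromℚ : ℚ → ℝ
fromℚ q .seq    _     = q
fromℚ q .cauchy δ 0<δ = 0 , λ _ _ _ _ →
  subst (λ p → ℚ.∣ p ∣ ℚ.< δ) (sym (ℚ.+-inverseʳ q)) 0<δ

0ℝ 1ℝ : ℝ
0ℝ = fromℚ 0ℚ
1ℝ = fromℚ 1ℚ

fromℕ : ℕ → ℝ
fromℕ n = fromℚ (+ n ℚ./ 1)

_+ℝ_ : ℝ → ℝ → ℝ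
(x +ℝ y) .seq n = seq x n ℚ.+ seq y n
(x +ℝ y) .cauchy δ 0<δ = M ⊔ M′ , λ m n m≥ n≥ → begin-strict
  ℚ.∣ (seq x m ℚ.+ seq y m) ℚ.- (seq x n ℚ.+ seq y n) ∣
    ≡⟨ cong ℚ.∣_∣ (regroup (seq x m) (seq y m) (seq x n) (seq y n)) ⟩
  ℚ.∣ (seq x m ℚ.- seq x n) ℚ.+ (seq y m ℚ.- seq y n) ∣
    ≤⟨ ℚ.∣p+q∣≤∣p∣+∣q∣ (seq x m ℚ.- seq x n) (seq y m ℚ.- seq y n) ⟩
  ℚ.∣ seq x m ℚ.- seq x n ∣ ℚ.+ ℚ.∣ seq y m ℚ.- seq y n ∣
    <⟨ ℚ.+-mono-< (cx m n (ℕ.m⊔n≤o⇒m≤o M M′ m≥) (ℕ.m⊔n≤o⇒m≤o M M′ n≥))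
                  (cy m n (ℕ.m⊔n≤o⇒n≤o M M′ m≥) (ℕ.m⊔n≤o⇒n≤o M M′ n≥)) ⟩
  ½ ℚ.* δ ℚ.+ ½ ℚ.* δ
    ≡⟨ ℚ.*-distribʳ-+ δ ½ ½ ⟨
  1ℚ ℚ.* δ
    ≡⟨ ℚ.*-identityˡ δ ⟩
  δ ∎
  where
  open ℚ.≤-Reasoning
  0<½δ : 0ℚ ℚ.< ½ ℚ.* δ
  0<½δ = subst (ℚ._< ½ ℚ.* δ) (ℚ.*-zeroʳ ½) (ℚ.*-monoʳ-<-pos ½ 0<δ)

  M  = proj₁ (cauchy x (½ ℚ.* δ) 0<½δ)
  cx = proj₂ (cauchy x (½ ℚ.* δ) 0<½δ)
  M′ = proj₁ (cauchy y (½ ℚ.* δ) 0<½δ)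
  cy = proj₂ (cauchy y (½ ℚ.* δ) 0<½δ)

  regroup : ∀ a b c d → (a ℚ.+ b) ℚ.- (c ℚ.+ d) ≡ (a ℚ.- c) ℚ.+ (b ℚ.- d)
  regroup = solve 4 (λ a b c d → (a :+ b) :- (c :+ d) := (a :- c) :+ (b :- d)) refl
    where open +-*-Solver

+ℝ-rawMonoid : RawMonoid 0ℓ 0ℓ
+ℝ-rawMonoid = record { Carrier = ℝ ; _≈_ = _≈ℝ_ ; _∙_ = _+ℝ_ ; ε = 0ℝ }

open RawMonoidDefs +ℝ-rawMonoid public using (sum)

------------------------------------------------------------------------
-- Finite simple graphs

-- The vertex set is a subset of an ambient Fin N, so that G, its subgraphs
-- and the graphs G ∖ X can be compared as subobjects of the same Fin N.

record Graph (N : ℕ) : Set₁ where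
  field
    V        : Subset N
    Adj      : Rel (Fin N) 0ℓ
    adj?     : Decidable Adj
    adj-sym  : Symmetric Adj
    adj-irr  : Irreflexive _≡_ Adj
    adj⇒∈V   : ∀ {x y} → Adj x y → x ∈ V

open Graph public

private variable
  N M : ℕ

-- Membership is kept irrelevant, so functions on Vertex G depend only on
-- the underlying element of Fin N.
Vertex : Graph N → Set
Vertex {N} G = [ x ∈ Fin N ∣ x ∈ V G ]

infix 4 _⊑_
_⊑_ : Rel (Graph N) 0ℓ
H ⊑ G = V H ⊆ V G × Adj H ⇒ Adj G

infix 8 _[_]
_[_] : Graph N → Subset N → Graph N
(G [ S ]) .V = V G ∩ S
(G [ S ]) .Adj x y = Adj G x y × x ∈ S × y ∈ S
(G [ S ]) .adj? x y = adj? G x y ×-dec x ∈? S ×-dec y ∈? S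
(G [ S ]) .adj-sym (e , x∈S , y∈S) = adj-sym G e , y∈S , x∈S
(G [ S ]) .adj-irr x≡y (e , _) = adj-irr G x≡y e
(G [ S ]) .adj⇒∈V (e , x∈S , _) = x∈p∩q⁺ (adj⇒∈V G e , x∈S)

infixl 8 _∖_
_∖_ : Graph N → Subset N → Graph N
G ∖ X = G [ V G ─ X ]

K : ∀ n → Graph n
K n .V = ⊤
K n .Adj = _≢_
K n .adj? x y = ¬? (x Fin.≟ y)
K n .adj-sym x≢y = x≢y ∘ sym
K n .adj-irr x≡y x≢y = x≢y x≡y
K n .adj⇒∈V _ = ∈⊤

infix 4 _≅_
record _≅_ (G : Graph N) (H : Graph M) : Set where
  field
    vertices : Vertex G ↔ Vertex H
    adjacent : ∀ x y → Adj G (value x) (value y) ⇔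
                       Adj H (value (Inverse.to vertices x)) (value (Inverse.to vertices y))

------------------------------------------------------------------------
-- Connected components

Connected : Graph N → Rel (Fin N) 0ℓ
Connected G = Star (Adj G)

-- Connected is decidable, by Warshall's algorithm: Via k relates vertices
-- joined by a walk all of whose interior vertices have index below k.

module Warshall {N} (G : Graph N) where

  Via : ℕ → Rel (Fin N) 0ℓ
  Via zero    x y = x ≡ y ⊎ Adj G x y
  Via (suc k) x y = Via k x y ⊎ (∃ λ z → toℕ z ≡ k × Via k x z × Via k z y)

  via? : ∀ k → Decidable (Via k)
  via? zero    x y = x Fin.≟ y ⊎-dec adj? G x y
  via? (suc k) x y = via? k x y ⊎-dec
    Fin.any? (λ z → toℕ z ℕ.≟ k ×-dec via? k x z ×-dec via? k z y)

  base : ∀ k {x y} → Via zero x y → Via k x y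
  base zero    p = p
  base (suc k) p = inj₁ (base k p)

  sound : ∀ k {x y} → Via k x y → Connected G x y
  sound zero    (inj₁ refl)             = ε
  sound zero    (inj₂ e)                = e ◅ ε
  sound (suc k) (inj₁ p)                = sound k p
  sound (suc k) (inj₂ (_ , _ , p , q)) = sound k p ◅◅ sound k q

  into : ∀ k {x z} → toℕ z ≡ k → Via (suc k) x z → Via k x z
  into k eq (inj₁ p) = p
  into k eq (inj₂ (w , eq′ , p , _)) =
    subst (Via k _) (toℕ-injective (trans eq′ (sym eq))) p

  outof : ∀ k {z y} → toℕ z ≡ k → Via (suc k) z y → Via k z y
  outof k eq (inj₁ p) = p
  outof k eq (inj₂ (w , eq′ , _ , q)) =
    subst (λ v → Via k v _) (toℕ-injective (trans eq′ (sym eq))) q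

  join : ∀ k {x z y} → toℕ z < k → Via k x z → Via k z y → Via k x y
  join (suc k) {z = z} z<1+k p q with ℕ.<-cmp (toℕ z) k
  ... | tri≈ _ z≡k _ = inj₂ (z , z≡k , into k z≡k p , outof k z≡k q)
  ... | tri> _ _ z>k with () ← ℕ.<⇒≱ z>k (ℕ.≤-pred z<1+k)
  ... | tri< z<k _ _ with p | q
  ...   | inj₁ p₁ | inj₁ q₁ = inj₁ (join k z<k p₁ q₁)
  ...   | inj₁ p₁ | inj₂ (w , eq , q₁ , q₂) = inj₂ (w , eq , join k z<k p₁ q₁ , q₂)
  ...   | inj₂ (w , eq , p₁ , p₂) | inj₁ q₁ = inj₂ (w , eq , p₁ , join k z<k p₂ q₁)
  ...   | inj₂ (w , eq , p₁ , _) | inj₂ (w′ , eq′ , _ , q₂)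
        with refl ← toℕ-injective (trans eq (sym eq′)) = inj₂ (w , eq , p₁ , q₂)

  complete : ∀ {x y} → Connected G x y → Via N x y
  complete ε = base N (inj₁ refl)
  complete (_◅_ {j = z} e p) = join N (toℕ<n z) (base N (inj₂ e)) (complete p)

connected? : (G : Graph N) → Decidable (Connected G)
connected? {N} G x y = map′ (sound N) complete (via? N x y)
  where open Warshall G

class : Graph N → Fin N → Subset N
class G x = tabulate (λ y → does (connected? G x y))

components : Graph N → List (Graph N)
components {N} G = map (G [_]) (deduplicate (Vec.≡-dec Bool._≟_) classes)
  where classes = map (class G) (filter (_∈? V G) (allFin N))

ω : Graph N → ℕ
ω = length ∘ components

record IsCompleteFactor (F G : Graph N) : Set₁ where
  field
    subgraph : F ⊑ G
    spanning : V F ≡ V G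
    complete : ∀ C → C ∈ˡ components F → ∃ λ n → n ≥ 1 × C ≅ K n

------------------------------------------------------------------------
-- Fractional factors

ℤ⁺ : Set
ℤ⁺ = [ n ∈ ℕ ∣ 1 ≤ n ]

infix 4 _≤⁺_
_≤⁺_ : Rel ℤ⁺ 0ℓ
m ≤⁺ n = value m ≤ value n

restrict : (G : Graph N) (S : Subset N) → (Vertex G → ℤ⁺) → (Vertex (G [ S ]) → ℤ⁺)
restrict G S f = f ∘ refine (p∩q⊆p (V G) S)

-- A function on the edges of G is given on oriented edges, and is required
-- to take the same value on both orientations (see FractionalFactor.h-sym).
EdgeFunction : Graph N → Set
EdgeFunction G = ∀ {x y} → Adj G x y → ℝ

-- The sum of h over the edges incident with x.
sumAt : (G : Graph N) → EdgeFunction G → Fin N → ℝ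
sumAt G h x = sum λ y → [ h {x} {y} , const 0ℝ ]′ (toSum (adj? G x y))

record FractionalFactor (G : Graph N) (r : Vertex G → ℤ⁺) : Set where
  field
    h     : EdgeFunction G
    h-sym : ∀ {x y} (e : Adj G x y) (e′ : Adj G y x) → h e ≈ℝ h e′
    0≤h   : ∀ {x y} (e : Adj G x y) → 0ℝ ≤ℝ h e
    h≤1   : ∀ {x y} (e : Adj G x y) → h e ≤ℝ 1ℝ
    sum≈r : ∀ (x : Vertex G) → sumAt G h (value x) ≈ℝ fromℕ (value (r x))

  -- The edge set of F_h; it need not be decidable, so F_h is not a Graph here.
  FactorAdj : Rel (Fin N) 0ℓ
  FactorAdj x y = Σ (Adj G x y) λ e → 0ℝ <ℝ h e

open FractionalFactor public using (FactorAdj)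

-- H is only required to share the ambient Fin N with G.
AllFractionalFactorsExcluding : (H G : Graph N) (g f : Vertex G → ℤ⁺) → Set
AllFractionalFactorsExcluding H G g f =
  ∀ (r : Vertex G → ℤ⁺) → (∀ x → g x ≤⁺ r x × r x ≤⁺ f x) →
  Σ (FractionalFactor G r) λ Fh → ∀ x y → ¬ (Adj H x y × FactorAdj Fh x y)

-- The required factor is an average: if F has k + 1 components C, and h_C is a
-- fractional r-factor of G − V(C) avoiding H, extended by 0 to the edges of G,
-- take h = (1/k) Σ_C h_C.  Every vertex lies in exactly one component, so
-- exactly k of the h_C contribute r(x) to its degree, and at most k of them
-- contribute to a given edge.

module Submission where

open import Defs
open import Algebra.Bundles using (CommutativeMonoid)
import Algebra.Definitions.RawMonoid as RawMonoidDefs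
import Algebra.Properties.CommutativeMonoid.Sum as Sum
open import Data.Bool.Properties as Bool using ()
open import Data.Fin.Base using (Fin; zero; suc; punchIn)
open import Data.Fin.Properties using (punchInᵢ≢i)
open import Data.Fin.Subset as Subset using (Subset; _─_; _∉_)
open import Data.Fin.Subset.Properties
  using (_∈?_; ⊆-antisym; p∩q⊆p; x∈p∩q⁺; x∈p∩q⁻; x∈p∧x∉q⇒x∈p─q)
open import Data.Irrelevant using () renaming ([_] to irr)
open import Data.List.Base using (List; length; lookup; map; filter; allFin; deduplicate)
open import Data.List.Membership.Propositional using (_∈_)
open import Data.List.Membership.Propositional.Properties
  using (∈-map⁺; ∈-map⁻; ∈-filter⁺; ∈-allFin; ∈-lookup; ∈-deduplicate⁺; ∈-deduplicate⁻)
open import Data.List.Properties using (length-map)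
import Data.List.Relation.Unary.All as All
open import Data.List.Relation.Unary.AllPairs using (_∷_)
open import Data.List.Relation.Unary.Any using (index)
open import Data.List.Relation.Unary.Any.Properties using (lookup-index)
import Data.List.Relation.Unary.Unique.DecPropositional.Properties as Unique
open import Data.List.Relation.Unary.Unique.Propositional using (Unique)
open import Data.Nat.Base using (ℕ; zero; suc; _+_; _≥_; _⊔_; s≤s)
import Data.Nat.Properties as ℕ
open import Data.Product.Base using (∃; _×_; _,_; proj₁; proj₂)
open import Data.Rational.Base as ℚ using (ℚ; 0ℚ; 1ℚ; ½)
import Data.Rational.Properties as ℚ
open import Data.Rational.Solver using (module +-*-Solver)
open import Data.Refinement using (value; refine; _,_)
open import Data.Sum.Base using (inj₁; inj₂; [_,_]′)
open import Data.Vec.Base using (_∷_; there)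
open import Data.Vec.Functional using (removeAt)
import Data.Vec.Properties as Vec
open import Function.Base using (_∘_; const)
open import Level using (0ℓ)
open import Relation.Binary.Construct.Closure.ReflexiveTransitive using (ε; _◅◅_; reverse)
open import Relation.Binary.Definitions using (Reflexive; Symmetric; Transitive)
open import Relation.Binary.PropositionalEquality
  using (_≡_; _≢_; refl; sym; trans; cong; cong₂; subst; subst₂)
open import Relation.Nullary.Decidable
  using (does; proof; yes; no; toSum; recompute; dec-true)
open import Relation.Nullary.Reflects using (Reflects; invert)
open import Relation.Nullary.Negation using (¬_; contradiction)

private variable
  N : ℕ
  x y z u v : ℝ

-- Real arithmetic

eventually₂ : {P Q R : ℕ → Set} → (∀ {n} → P n → Q n → R n) →
              Eventually P → Eventually Q → Eventually R
eventually₂ f (M , p) (M′ , q) = M ⊔ M′ , λ n n≥ →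
  f (p n (ℕ.m⊔n≤o⇒m≤o M M′ n≥)) (q n (ℕ.m⊔n≤o⇒n≤o M M′ n≥))

eventually : {P Q : ℕ → Set} → (∀ {n} → P n → Q n) → Eventually P → Eventually Q
eventually f (M , p) = M , λ n n≥ → f (p n n≥)

0<½* : ∀ {δ} → 0ℚ ℚ.< δ → 0ℚ ℚ.< ½ ℚ.* δ
0<½* {δ} 0<δ = subst (ℚ._< ½ ℚ.* δ) (ℚ.*-zeroʳ ½) (ℚ.*-monoʳ-<-pos ½ 0<δ)

½*+½* : ∀ δ → ½ ℚ.* δ ℚ.+ ½ ℚ.* δ ≡ δ
½*+½* δ = trans (sym (ℚ.*-distribʳ-+ δ ½ ½)) (ℚ.*-identityˡ δ)

p≤∣p∣ : ∀ p → p ℚ.≤ ℚ.∣ p ∣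
p≤∣p∣ p with ℚ.≤-total 0ℚ p
... | inj₁ 0≤p = ℚ.≤-reflexive (sym (ℚ.0≤p⇒∣p∣≡p 0≤p))
... | inj₂ p≤0 = ℚ.≤-trans p≤0 (ℚ.0≤∣p∣ p)

p-q<r⇒p<q+r : ∀ {p q r} → p ℚ.- q ℚ.< r → p ℚ.< q ℚ.+ r
p-q<r⇒p<q+r {p} {q} p-q<r = subst (ℚ._< q ℚ.+ _)
  (solve 2 (λ p q → q :+ (p :- q) := p) refl p q) (ℚ.+-monoʳ-< q p-q<r)
  where open +-*-Solver

∣p-q∣<r⇒p<q+r : ∀ p q {r} → ℚ.∣ p ℚ.- q ∣ ℚ.< r → p ℚ.< q ℚ.+ r
∣p-q∣<r⇒p<q+r p q d = p-q<r⇒p<q+r {p} {q} (ℚ.≤-<-trans (p≤∣p∣ (p ℚ.- q)) d)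

∣p-q∣≡∣q-p∣ : ∀ p q → ℚ.∣ p ℚ.- q ∣ ≡ ℚ.∣ q ℚ.- p ∣
∣p-q∣≡∣q-p∣ p q = trans (sym (ℚ.∣-p∣≡∣p∣ (p ℚ.- q)))
  (cong ℚ.∣_∣ (solve 2 (λ p q → :- (p :- q) := q :- p) refl p q))
  where open +-*-Solver

-- The half-`δ` argument behind transitivity and congruence of `_≈ℝ_`: a difference is split into
-- two differences, each kept below half of `δ`.
∣∣<-+ : ∀ {p} q r {δ} → p ≡ q ℚ.+ r →
        ℚ.∣ q ∣ ℚ.< ½ ℚ.* δ → ℚ.∣ r ∣ ℚ.< ½ ℚ.* δ → ℚ.∣ p ∣ ℚ.< δ
∣∣<-+ q r {δ} refl q< r< = ℚ.≤-<-trans (ℚ.∣p+q∣≤∣p∣+∣q∣ q r)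
  (subst (ℚ.∣ q ∣ ℚ.+ ℚ.∣ r ∣ ℚ.<_) (½*+½* δ) (ℚ.+-mono-< q< r<))

≗⇒≈ : (∀ n → seq x n ≡ seq y n) → x ≈ℝ y
≗⇒≈ {x} eq δ 0<δ = 0 , λ n _ → subst (λ p → ℚ.∣ p ∣ ℚ.< δ)
  (sym (trans (cong (λ p → seq x n ℚ.- p) (sym (eq n))) (ℚ.+-inverseʳ (seq x n)))) 0<δ

≈-refl : Reflexive _≈ℝ_
≈-refl {x} = ≗⇒≈ {x} {x} (λ _ → refl)

≈-sym : Symmetric _≈ℝ_
≈-sym {x} {y} x≈y δ 0<δ = eventually
  (λ {n} → subst (ℚ._< δ) (∣p-q∣≡∣q-p∣ (seq x n) (seq y n))) (x≈y δ 0<δ)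

≈-trans : Transitive _≈ℝ_
≈-trans {x} {y} {z} x≈y y≈z δ 0<δ = eventually₂
  (λ {n} → ∣∣<-+ _ _ (split (seq x n) (seq y n) (seq z n)))
  (x≈y _ (0<½* 0<δ)) (y≈z _ (0<½* 0<δ))
  where
  open +-*-Solver
  split : ∀ a b c → a ℚ.- c ≡ (a ℚ.- b) ℚ.+ (b ℚ.- c)
  split = solve 3 (λ a b c → a :- c := (a :- b) :+ (b :- c)) refl

+-cong : x ≈ℝ y → u ≈ℝ v → x +ℝ u ≈ℝ y +ℝ v
+-cong {x} {y} {u} {v} x≈y u≈v δ 0<δ = eventually₂
  (λ {n} → ∣∣<-+ _ _ (split (seq x n) (seq y n) (seq u n) (seq v n)))
  (x≈y _ (0<½* 0<δ)) (u≈v _ (0<½* 0<δ))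
  where
  open +-*-Solver
  split : ∀ a b c d → (a ℚ.+ c) ℚ.- (b ℚ.+ d) ≡ (a ℚ.- b) ℚ.+ (c ℚ.- d)
  split = solve 4 (λ a b c d → (a :+ c) :- (b :+ d) := (a :- b) :+ (c :- d)) refl

-- Supplies the general laws of finite sums: splitting off a term, interchanging two sums, and
-- summing a constant.
+ℝ-commutativeMonoid : CommutativeMonoid 0ℓ 0ℓ
+ℝ-commutativeMonoid = record
  { Carrier = ℝ ; _≈_ = _≈ℝ_ ; _∙_ = _+ℝ_ ; ε = 0ℝ
  ; isCommutativeMonoid = record
    { isMonoid = record
      { isSemigroup = record
        { isMagma = record
          { isEquivalence = record
            { refl  = λ {x} → ≈-refl {x}
            ; sym   = λ {x} {y} → ≈-sym {x} {y}
            ; trans = λ {x} {y} {z} → ≈-trans {x} {y} {z}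
            }
          ; ∙-cong = λ {x} {y} {u} {v} → +-cong {x} {y} {u} {v}
          }
        ; assoc = λ x y z → ≗⇒≈ {(x +ℝ y) +ℝ z} {x +ℝ (y +ℝ z)}
            (λ n → ℚ.+-assoc (seq x n) (seq y n) (seq z n))
        }
      ; identity = (λ x → ≗⇒≈ {0ℝ +ℝ x} {x} (λ n → ℚ.+-identityˡ (seq x n)))
                 , (λ x → ≗⇒≈ {x +ℝ 0ℝ} {x} (λ n → ℚ.+-identityʳ (seq x n)))
      }
    ; comm = λ x y → ≗⇒≈ {x +ℝ y} {y +ℝ x} (λ n → ℚ.+-comm (seq x n) (seq y n))
    }
  }

open Sum +ℝ-commutativeMonoid using (sum-remove; ∑-comm; sum-cong-≋; sum-replicate; sum-replicate-zero)
open CommutativeMonoid +ℝ-commutativeMonoid using (setoid; identityˡ; ∙-congʳ)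
open import Relation.Binary.Reasoning.Setoid setoid
open RawMonoidDefs +ℝ-rawMonoid using () renaming (_×_ to _×ℝ_)
open RawMonoidDefs ℚ.+-0-rawMonoid using () renaming (_×_ to _×ℚ_)

-- Order on the reals

≤-reflexive : x ≈ℝ y → x ≤ℝ y
≤-reflexive {x} {y} x≈y δ 0<δ = eventually
  (λ {n} → ∣p-q∣<r⇒p<q+r (seq x n) (seq y n)) (x≈y δ 0<δ)

+-mono-≤ : x ≤ℝ y → u ≤ℝ v → x +ℝ u ≤ℝ y +ℝ v
+-mono-≤ {x} {y} {u} {v} x≤y u≤v δ 0<δ = eventually₂
  (λ {n} p q → subst (seq x n ℚ.+ seq u n ℚ.<_)
    (trans (regroup (seq y n) (seq v n) (½ ℚ.* δ))
           (cong (seq y n ℚ.+ seq v n ℚ.+_) (½*+½* δ)))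
    (ℚ.+-mono-< p q))
  (x≤y _ (0<½* 0<δ)) (u≤v _ (0<½* 0<δ))
  where
  open +-*-Solver
  regroup : ∀ a b c → (a ℚ.+ c) ℚ.+ (b ℚ.+ c) ≡ (a ℚ.+ b) ℚ.+ (c ℚ.+ c)
  regroup = solve 3 (λ a b c → (a :+ c) :+ (b :+ c) := (a :+ b) :+ (c :+ c)) refl

≤-trans : Transitive _≤ℝ_
≤-trans {x} {y} {z} x≤y y≤z δ 0<δ = eventually₂
  (λ {n} p q → ℚ.<-trans p (subst (seq y n ℚ.+ ½ ℚ.* δ ℚ.<_)
    (trans (ℚ.+-assoc (seq z n) _ _) (cong (seq z n ℚ.+_) (½*+½* δ)))
    (ℚ.+-monoˡ-< (½ ℚ.* δ) q)))
  (x≤y _ (0<½* 0<δ)) (y≤z _ (0<½* 0<δ))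

≤⇒≯ : x ≤ℝ y → ¬ (y <ℝ x)
-- The same `δ` is used in both hypotheses, so they contradict each other at every large enough
-- index.
≤⇒≯ x≤y (δ , 0<δ , y<x) with eventually₂ ℚ.<-asym (x≤y δ 0<δ) y<x
... | M , absurd = absurd M ℕ.≤-refl

-- Excluded middle is avoided by comparing the single rational `seq x M` with three quarters of `δ`,
-- where terms from `M` on differ by less than a quarter of `δ`. If it lies below, all later terms
-- stay below `δ`; otherwise they all exceed half of `δ`, which would make `x` positive.
≯0⇒≤0 : ¬ (0ℝ <ℝ x) → x ≤ℝ 0ℝ
≯0⇒≤0 {x} x≯0 δ 0<δ = M , λ n n≥M → subst (seq x n ℚ.<_) (sym (ℚ.+-identityˡ δ)) (small n n≥M)
  where
  ½δ = ½ ℚ.* δ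
  ¼δ = ½ ℚ.* ½δ
  M  = proj₁ (cauchy x ¼δ (0<½* (0<½* 0<δ)))
  cx = proj₂ (cauchy x ¼δ (0<½* (0<½* 0<δ)))

  ¼δ<½δ : ¼δ ℚ.< ½δ
  ¼δ<½δ = subst₂ ℚ._<_ (ℚ.+-identityʳ ¼δ) (½*+½* ½δ) (ℚ.+-monoʳ-< ¼δ (0<½* (0<½* 0<δ)))

  xM<½δ+¼δ : seq x M ℚ.< ½δ ℚ.+ ¼δ
  xM<½δ+¼δ with seq x M ℚ.<? ½δ ℚ.+ ¼δ
  ... | yes xM< = xM<
  ... | no  xM≮ = contradiction (¼δ , 0<½* (0<½* 0<δ) , M , large) x≯0
    where
    large : ∀ n → n ≥ M → 0ℚ ℚ.+ ¼δ ℚ.< seq x n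
    large n n≥M = ℚ.≤-<-trans (ℚ.≤-reflexive (ℚ.+-identityˡ ¼δ)) (ℚ.<-trans ¼δ<½δ
      (ℚ.≰⇒> λ xn≤ → xM≮ (ℚ.<-≤-trans
        (∣p-q∣<r⇒p<q+r (seq x M) (seq x n) (cx M n ℕ.≤-refl n≥M))
        (ℚ.+-monoˡ-≤ ¼δ xn≤))))

  small : ∀ n → n ≥ M → seq x n ℚ.< δ
  small n n≥M = subst (seq x n ℚ.<_)
    (trans (ℚ.+-assoc ½δ ¼δ ¼δ) (trans (cong (½δ ℚ.+_) (½*+½* ½δ)) (½*+½* δ)))
    (ℚ.<-trans (∣p-q∣<r⇒p<q+r (seq x n) (seq x M) (cx n M n≥M ℕ.≤-refl))
               (ℚ.+-monoˡ-< ¼δ xM<½δ+¼δ))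

-- Finite sums of reals

sum-mono-≤ : ∀ {n} (s t : Fin n → ℝ) → (∀ i → s i ≤ℝ t i) → sum s ≤ℝ sum t
sum-mono-≤ {zero}  s t s≤t = ≤-reflexive {0ℝ} {0ℝ} (≈-refl {0ℝ})
sum-mono-≤ {suc n} s t s≤t = +-mono-≤ {s zero} {t zero} {sum (s ∘ suc)} {sum (t ∘ suc)}
  (s≤t zero) (sum-mono-≤ (s ∘ suc) (t ∘ suc) (s≤t ∘ suc))

sum-swap : ∀ {m n} (f : Fin m → Fin n → ℝ) → sum (λ i → sum (f i)) ≈ℝ sum (λ j → sum λ i → f i j)
sum-swap = ∑-comm

-- Used to discard the factor whose component contains a given vertex, which leaves one index fewer.
sum-remove-0 : ∀ {n} (t : Fin (suc n) → ℝ) i → t i ≈ℝ 0ℝ → sum t ≈ℝ sum (removeAt t i)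
sum-remove-0 t i tᵢ≈0 = begin
  sum t                         ≈⟨ sum-remove {i = i} t ⟩
  t i +ℝ sum (removeAt t i)     ≈⟨ ∙-congʳ {sum (removeAt t i)} {t i} {0ℝ} tᵢ≈0 ⟩
  0ℝ +ℝ sum (removeAt t i)      ≈⟨ identityˡ (sum (removeAt t i)) ⟩
  sum (removeAt t i)            ∎

-- Turns a repeated real sum into multiplication by a rational, which can then be cancelled by the
-- rational inverse.
seq-× : ∀ k x n → seq (k ×ℝ x) n ≡ (k ×ℚ 1ℚ) ℚ.* seq x n
seq-× zero    x n = sym (ℚ.*-zeroˡ (seq x n))
seq-× (suc k) x n = trans
  (cong₂ ℚ._+_ (sym (ℚ.*-identityˡ (seq x n))) (seq-× k x n))
  (sym (ℚ.*-distribʳ-+ (seq x n) 1ℚ (k ×ℚ 1ℚ)))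

0≤k×1 : ∀ k → 0ℚ ℚ.≤ k ×ℚ 1ℚ
0≤k×1 zero    = ℚ.≤-refl
0≤k×1 (suc k) = ℚ.+-mono-≤ (ℚ.nonNegative⁻¹ 1ℚ) (0≤k×1 k)

1≤1+k×1 : ∀ k → 1ℚ ℚ.≤ suc k ×ℚ 1ℚ
1≤1+k×1 k = ℚ.+-monoʳ-≤ 1ℚ (0≤k×1 k)

-- Division of reals by `suc k`

module _ (k : ℕ) where

  private
    c q : ℚ
    c = suc k ×ℚ 1ℚ

    instance
      c-positive : ℚ.Positive c
      c-positive = ℚ.positive (ℚ.<-≤-trans (ℚ.positive⁻¹ 1ℚ) (1≤1+k×1 k))

      c-nonZero : ℚ.NonZero c
      c-nonZero = ℚ.pos⇒nonZero c

    q = ℚ.1/ c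

    instance
      q-positive : ℚ.Positive q
      q-positive = ℚ.1/pos⇒pos c

      q-nonNegative : ℚ.NonNegative q
      q-nonNegative = ℚ.pos⇒nonNeg q

  q≤1 : q ℚ.≤ 1ℚ
  q≤1 = subst₂ ℚ._≤_ (ℚ.*-identityʳ q) (ℚ.*-inverseˡ c) (ℚ.*-monoˡ-≤-nonNeg q (1≤1+k×1 k))

  q*p≤p : ∀ {p} → 0ℚ ℚ.≤ p → q ℚ.* p ℚ.≤ p
  q*p≤p {p} 0≤p = subst (q ℚ.* p ℚ.≤_) (ℚ.*-identityˡ p)
    (ℚ.*-monoʳ-≤-nonNeg p {{ℚ.nonNegative 0≤p}} q≤1)

  -- Multiplication by `q` contracts distances because `q` lies between 0 and 1. Hence `divide`
  -- keeps the modulus of convergence of its argument and respects `_≈ℝ_` without rescaling `δ`.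
  ∣q*-q*∣≤ : ∀ a b → ℚ.∣ q ℚ.* a ℚ.- q ℚ.* b ∣ ℚ.≤ ℚ.∣ a ℚ.- b ∣
  ∣q*-q*∣≤ a b = subst (ℚ._≤ ℚ.∣ a ℚ.- b ∣)
    (sym (trans (cong ℚ.∣_∣ (factor q a b)) (trans (ℚ.∣p*q∣≡∣p∣*∣q∣ q (a ℚ.- b))
      (cong (ℚ._* ℚ.∣ a ℚ.- b ∣) (ℚ.0≤p⇒∣p∣≡p (ℚ.nonNegative⁻¹ q))))))
    (q*p≤p (ℚ.0≤∣p∣ (a ℚ.- b)))
    where
    open +-*-Solver
    factor : ∀ q a b → q ℚ.* a ℚ.- q ℚ.* b ≡ q ℚ.* (a ℚ.- b)
    factor = solve 3 (λ q a b → q :* a :- q :* b := q :* (a :- b)) refl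

  divide : ℝ → ℝ
  divide x .seq n = q ℚ.* seq x n
  divide x .cauchy δ 0<δ = proj₁ (cauchy x δ 0<δ) , λ m n m≥ n≥ →
    ℚ.≤-<-trans (∣q*-q*∣≤ (seq x m) (seq x n)) (proj₂ (cauchy x δ 0<δ) m n m≥ n≥)

  divide-cong : x ≈ℝ y → divide x ≈ℝ divide y
  divide-cong {x} {y} x≈y δ 0<δ = eventually
    (λ {n} → ℚ.≤-<-trans (∣q*-q*∣≤ (seq x n) (seq y n))) (x≈y δ 0<δ)

  divide-mono-≤ : x ≤ℝ y → divide x ≤ℝ divide y
  divide-mono-≤ {x} {y} x≤y δ 0<δ = eventually
    (λ {n} x< → ℚ.<-≤-trans (ℚ.*-monoʳ-<-pos q x<)
      (subst (ℚ._≤ q ℚ.* seq y n ℚ.+ δ) (sym (ℚ.*-distribˡ-+ q (seq y n) δ))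
        (ℚ.+-monoʳ-≤ (q ℚ.* seq y n) (q*p≤p (ℚ.<⇒≤ 0<δ)))))
    (x≤y δ 0<δ)

  divide-0 : divide 0ℝ ≈ℝ 0ℝ
  divide-0 = ≗⇒≈ {divide 0ℝ} {0ℝ} (λ _ → ℚ.*-zeroʳ q)

  divide-sum-0 : ∀ n → divide (sum {n} (const 0ℝ)) ≈ℝ 0ℝ
  divide-sum-0 n = begin
    divide (sum {n} (const 0ℝ))   ≈⟨ divide-cong {sum {n} (const 0ℝ)} {0ℝ} (sum-replicate-zero n) ⟩
    divide 0ℝ                     ≈⟨ divide-0 ⟩
    0ℝ                            ∎

  divide-sum : ∀ {n} (t : Fin n → ℝ) → divide (sum t) ≈ℝ sum (divide ∘ t)
  divide-sum {zero}  t = divide-0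
  divide-sum {suc n} t = begin
    divide (t zero +ℝ sum (t ∘ suc))
      ≈⟨ ≗⇒≈ {divide (t zero +ℝ sum (t ∘ suc))} {divide (t zero) +ℝ divide (sum (t ∘ suc))}
           (λ m → ℚ.*-distribˡ-+ q (seq (t zero) m) (seq (sum (t ∘ suc)) m)) ⟩
    divide (t zero) +ℝ divide (sum (t ∘ suc))
      ≈⟨ +-cong {divide (t zero)} {divide (t zero)} {divide (sum (t ∘ suc))} {sum (divide ∘ t ∘ suc)}
           (≈-refl {divide (t zero)}) (divide-sum (t ∘ suc)) ⟩
    sum (divide ∘ t) ∎

  -- The normalisation of the average: `suc k` equal terms add up to a multiple by `c`, which `q`
  -- cancels. It serves both for the degree `r x` and for the bound 1 on an edge.
  divide-sum-const : ∀ x → divide (sum {suc k} (const x)) ≈ℝ x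
  divide-sum-const x = begin
    divide (sum {suc k} (const x))
      ≈⟨ divide-cong {sum {suc k} (const x)} {suc k ×ℝ x} (sum-replicate (suc k) {x}) ⟩
    divide (suc k ×ℝ x)
      ≈⟨ ≗⇒≈ {divide (suc k ×ℝ x)} {x} (λ n →
           trans (cong (q ℚ.*_) (seq-× (suc k) x n))
          (trans (sym (ℚ.*-assoc q c (seq x n)))
          (trans (cong (ℚ._* seq x n) (ℚ.*-inverseˡ c))
                 (ℚ.*-identityˡ (seq x n))))) ⟩
    x ∎

-- Averages of fractional factors

x∈p─q⇒x∉q : ∀ {n} {x : Fin n} (p q : Subset n) → x Subset.∈ p ─ q → x ∉ q
x∈p─q⇒x∉q (_ ∷ p) (_ ∷ q) (there x∈) (there x∈q) = x∈p─q⇒x∉q p q x∈ x∈q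

-- The same summand as in `sumAt`, so that `sumAt G h x` is definitionally `sum (extend G h x)`. As
-- functions on all pairs, the weights from the different graphs `G ∖ X i` can be added.
extend : (G : Graph N) → EdgeFunction G → Fin N → Fin N → ℝ
extend G h x y = [ h {x} {y} , const 0ℝ ]′ (toSum (adj? G x y))

module _ (G : Graph N) (h : EdgeFunction G) where

  extend-elim : ∀ {ℓ} (P : ℝ → Set ℓ) {x y} →
                (∀ (e : Adj G x y) → P (h e)) → P 0ℝ → P (extend G h x y)
  extend-elim P {x} {y} p p₀ with adj? G x y
  ... | yes e = p e
  ... | no  _ = p₀

  extend-¬adj : ∀ {x y} → ¬ Adj G x y → extend G h x y ≈ℝ 0ℝ
  extend-¬adj ¬e = extend-elim (_≈ℝ 0ℝ) (λ e → contradiction e ¬e) (≈-refl {0ℝ})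

  extend-sym : (∀ {x y} (e : Adj G x y) (e′ : Adj G y x) → h e ≈ℝ h e′) →
               ∀ x y → extend G h x y ≈ℝ extend G h y x
  extend-sym h-sym x y with adj? G x y | adj? G y x
  ... | yes e | yes e′ = h-sym e e′
  ... | yes e | no ¬e′ = contradiction (adj-sym G e) ¬e′
  ... | no ¬e | yes e′ = contradiction (adj-sym G e′) ¬e
  ... | no _  | no _   = ≈-refl {0ℝ}

-- Meant for the average, which is defined on all pairs and vanishes off the edges of `G`:
-- restricting it to edges and extending it again changes nothing.
extend-const : (G : Graph N) (z : ℝ) → ∀ {x y} → (¬ Adj G x y → z ≈ℝ 0ℝ) →
               extend G (λ _ → z) x y ≈ℝ z
extend-const G z {x} {y} z≈0 with adj? G x y
... | yes _ = ≈-refl {z}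
... | no ¬e = ≈-sym {z} {0ℝ} (z≈0 ¬e)

0≤0 : 0ℝ ≤ℝ 0ℝ
0≤0 = ≤-reflexive {0ℝ} {0ℝ} (≈-refl {0ℝ})

0≤1 : 0ℝ ≤ℝ 1ℝ
0≤1 δ 0<δ = 0 , λ _ _ → ℚ.+-mono-≤-< (ℚ.nonNegative⁻¹ 1ℚ) 0<δ

-- The sets `X i` stand for the vertex sets of the components. There are `2 + k` of them, so each
-- vertex survives in exactly `1 + k` of the graphs `G ∖ X i`; `divide k` divides by this number,
-- which is never zero.
module Average
  (G : Graph N) {k : ℕ} (X : Fin (2 + k) → Subset N)
  (partition : ∀ {x} → x Subset.∈ V G → ∃ λ i → x Subset.∈ X i × ∀ j → i ≢ j → x ∉ X j)
  (r : Vertex G → ℤ⁺)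
  (factor : ∀ i → FractionalFactor (G ∖ X i) (restrict G (V G ─ X i) r))
  where

  private
    module F i = FractionalFactor (factor i)

  w : Fin (2 + k) → Fin N → Fin N → ℝ
  w i = extend (G ∖ X i) (F.h i)

  average : Fin N → Fin N → ℝ
  average x y = divide k (sum λ i → w i x y)

  average-cong : ∀ {x y x′ y′} → (∀ i → w i x y ≈ℝ w i x′ y′) → average x y ≈ℝ average x′ y′
  average-cong {x} {y} {x′} {y′} eq = divide-cong k {sum λ i → w i x y} {sum λ i → w i x′ y′}
    (sum-cong-≋ {_} {λ i → w i x y} {λ i → w i x′ y′} eq)

  w-deleted : ∀ i {x} → x Subset.∈ X i → ∀ y → w i x y ≈ℝ 0ℝ
  w-deleted i x∈Xᵢ y = extend-¬adj (G ∖ X i) (F.h i)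
    (λ (_ , x∈ , _) → x∈p─q⇒x∉q (V G) (X i) x∈ x∈Xᵢ)

  0≤average : ∀ x y → 0ℝ ≤ℝ average x y
  0≤average x y = ≤-trans {0ℝ} {divide k (sum {2 + k} (const 0ℝ))} {average x y}
    (≤-reflexive {0ℝ} {divide k (sum {2 + k} (const 0ℝ))}
      (≈-sym {divide k (sum {2 + k} (const 0ℝ))} {0ℝ} (divide-sum-0 k (2 + k))))
    (divide-mono-≤ k {sum {2 + k} (const 0ℝ)} {sum λ i → w i x y} (sum-mono-≤ (const 0ℝ) (λ i → w i x y) λ i →
      extend-elim (G ∖ X i) (F.h i) (0ℝ ≤ℝ_) {x} {y} (F.0≤h i) 0≤0))

  average≤0 : ∀ x y → (∀ i → w i x y ≤ℝ 0ℝ) → average x y ≤ℝ 0ℝ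
  average≤0 x y w≤0 = ≤-trans {average x y} {divide k (sum {2 + k} (const 0ℝ))} {0ℝ}
    (divide-mono-≤ k {sum λ i → w i x y} {sum {2 + k} (const 0ℝ)} (sum-mono-≤ (λ i → w i x y) (const 0ℝ) w≤0))
    (≤-reflexive {divide k (sum {2 + k} (const 0ℝ))} {0ℝ} (divide-sum-0 k (2 + k)))

  -- The factor that deletes `x` contributes 0, and each of the other `1 + k` contributes at most 1.
  average≤1 : ∀ {x} → x Subset.∈ V G → ∀ y → average x y ≤ℝ 1ℝ
  average≤1 {x} x∈G y with partition x∈G
  ... | i , x∈Xᵢ , _ = ≤-trans {average x y} {divide k (sum {suc k} (const 1ℝ))} {1ℝ}
    (divide-mono-≤ k {sum λ j → w j x y} {sum {suc k} (const 1ℝ)}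
      (≤-trans {sum λ j → w j x y} {sum (removeAt (λ j → w j x y) i)} {sum {suc k} (const 1ℝ)}
        (≤-reflexive {sum λ j → w j x y} {sum (removeAt (λ j → w j x y) i)}
          (sum-remove-0 (λ j → w j x y) i (w-deleted i x∈Xᵢ y)))
        (sum-mono-≤ (removeAt (λ j → w j x y) i) (const 1ℝ) λ j → let i′ = punchIn i j in
          extend-elim (G ∖ X i′) (F.h i′) (_≤ℝ 1ℝ) {x} {y} (F.h≤1 i′) 0≤1)))
    (≤-reflexive {divide k (sum {suc k} (const 1ℝ))} {1ℝ} (divide-sum-const k 1ℝ))

  average-¬adj : ∀ {x y} → ¬ Adj G x y → average x y ≈ℝ 0ℝ
  average-¬adj {x} {y} ¬e = begin
    divide k (sum λ i → w i x y)
      ≈⟨ divide-cong k {sum λ i → w i x y} {sum {2 + k} (const 0ℝ)}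
           (sum-cong-≋ {_} {λ i → w i x y} {const 0ℝ} λ i →
             extend-¬adj (G ∖ X i) (F.h i) (¬e ∘ proj₁)) ⟩
    divide k (sum {2 + k} (const 0ℝ))
      ≈⟨ divide-sum-0 k (2 + k) ⟩
    0ℝ ∎

  sum-w-deleted : ∀ i {x} → x Subset.∈ X i → sum (w i x) ≈ℝ 0ℝ
  sum-w-deleted i {x} x∈Xᵢ = begin
    sum (w i x)          ≈⟨ sum-cong-≋ {_} {w i x} {const 0ℝ} (w-deleted i x∈Xᵢ) ⟩
    sum {N} (const 0ℝ)   ≈⟨ sum-replicate-zero N ⟩
    0ℝ                   ∎

  sum-w-remaining : ∀ i {x} (x∈G : x Subset.∈ V G) → x ∉ X i →
                    sum (w i x) ≈ℝ fromℕ (value (r (x , irr x∈G)))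
  sum-w-remaining i {x} x∈G x∉Xᵢ =
    -- Membership proofs are irrelevant, so the restricted function agrees with `r` at `x`
    -- definitionally, and the degree condition of factor `i` applies as it is.
    F.sum≈r i (x , irr (x∈p∩q⁺ (x∈G , x∈p∧x∉q⇒x∈p─q x∈G x∉Xᵢ)))

  sum-average : (x : Vertex G) → sum (average (value x)) ≈ℝ fromℕ (value (r x))
  sum-average (x , irr x∈G′) = begin
    sum (λ y → divide k (sum λ j → w j x y))
      ≈⟨ divide-sum k (λ y → sum λ j → w j x y) ⟨
    divide k (sum λ y → sum λ j → w j x y)
      -- Double counting: summing over the neighbours first gives, for each factor, its degree at
      -- `x`.
      ≈⟨ divide-cong k {sum λ y → sum λ j → w j x y} {sum λ j → sum (w j x)} (sum-swap λ y j → w j x y) ⟩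
    divide k (sum λ j → sum (w j x))
      -- Factor `i` lives on a graph without `x`, so its degree there is 0; all the others keep `x`
      -- and have degree `r x`.
      ≈⟨ divide-cong k {sum λ j → sum (w j x)} {sum (removeAt (λ j → sum (w j x)) i)}
           (sum-remove-0 (λ j → sum (w j x)) i (sum-w-deleted i x∈Xᵢ)) ⟩
    divide k (sum (removeAt (λ j → sum (w j x)) i))
      ≈⟨ divide-cong k {sum (removeAt (λ j → sum (w j x)) i)} {sum {suc k} (const rₓ)}
           (sum-cong-≋ {_} {removeAt (λ j → sum (w j x)) i} {const rₓ} λ j →
             sum-w-remaining (punchIn i j) x∈G (unique (punchIn i j) (punchInᵢ≢i i j ∘ sym))) ⟩
    divide k (sum {suc k} (const rₓ))
      ≈⟨ divide-sum-const k rₓ ⟩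
    rₓ ∎
    where
    -- A vertex carries only an irrelevant membership proof; decidability recovers a relevant one,
    -- from which `partition` can compute an index.
    x∈G = recompute (x ∈? V G) x∈G′
    rₓ = fromℕ (value (r (x , irr x∈G)))

    i = proj₁ (partition x∈G)
    x∈Xᵢ = proj₁ (proj₂ (partition x∈G))
    unique = proj₂ (proj₂ (partition x∈G))

  factor-average : FractionalFactor G r
  factor-average = record
    { h     = λ {x} {y} _ → average x y
    ; h-sym = λ {x} {y} _ _ → average-cong {x} {y} {y} {x}
                λ i → extend-sym (G ∖ X i) (F.h i) (F.h-sym i) x y
    ; 0≤h   = λ {x} {y} _ → 0≤average x y
    ; h≤1   = λ {x} {y} e → average≤1 (adj⇒∈V G e) y
    ; sum≈r = λ x → begin
        sum (extend G (λ {x} {y} _ → average x y) (value x))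
          ≈⟨ sum-cong-≋ {_} {extend G (λ {x} {y} _ → average x y) (value x)} {average (value x)}
               (extend-average (value x)) ⟩
        sum (average (value x))
          ≈⟨ sum-average x ⟩
        fromℕ (value (r x)) ∎
    }
    where
    extend-average : ∀ x y → extend G (λ {x} {y} _ → average x y) x y ≈ℝ average x y
    extend-average x y = extend-const G (average x y) (average-¬adj {x} {y})

  -- If no factor were positive on the edge, every weight would be at most 0 and so would the
  -- average. The double negation suffices because avoiding `H` is itself a negated statement.
  factorAdj-average : ∀ {x y} → FactorAdj factor-average x y → ¬ ¬ (∃ λ i → FactorAdj (factor i) x y)
  factorAdj-average {x} {y} (_ , 0<h) none = ≤⇒≯ {average x y} {0ℝ}
    (average≤0 x y λ i → extend-elim (G ∖ X i) (F.h i) (_≤ℝ 0ℝ) {x} {y}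
      (λ e → ≯0⇒≤0 {F.h i e} λ 0<hᵢ → none (i , e , 0<hᵢ)) 0≤0)
    0<h

-- Components

lookup-injective : ∀ {a} {A : Set a} {xs : List A} → Unique xs →
                   ∀ {i j} → lookup xs i ≡ lookup xs j → i ≡ j
lookup-injective (_ ∷ _)        {zero}  {zero}  _  = refl
lookup-injective (x∉xs ∷ _)     {zero}  {suc j} eq = contradiction eq (All.lookup x∉xs (∈-lookup j))
lookup-injective (x∉xs ∷ _)     {suc i} {zero}  eq = contradiction (sym eq) (All.lookup x∉xs (∈-lookup i))
lookup-injective (_ ∷ unique)   {suc i} {suc j} eq = cong suc (lookup-injective unique eq)

module _ (F : Graph N) where

  ∈class⁺ : ∀ {x y} → Connected F x y → y Subset.∈ class F x
  ∈class⁺ {x} {y} p = Vec.lookup⇒[]= y _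
    (trans (Vec.lookup∘tabulate _ y) (dec-true (connected? F x y) p))

  ∈class⁻ : ∀ {x y} → y Subset.∈ class F x → Connected F x y
  ∈class⁻ {x} {y} y∈ = invert (subst (Reflects (Connected F x y))
    (trans (sym (Vec.lookup∘tabulate (does ∘ connected? F x) y)) (Vec.[]=⇒lookup y∈))
    (proof (connected? F x y)))

  class-cong : ∀ {x y} → Connected F x y → class F x ≡ class F y
  class-cong p = ⊆-antisym
    (λ z∈ → ∈class⁺ (reverse (adj-sym F) p ◅◅ ∈class⁻ z∈))
    (λ z∈ → ∈class⁺ (p ◅◅ ∈class⁻ z∈))

  -- The list inside `components`, so that `components F` is definitionally
  -- `map (F [_]) (classes F)`. Its positions index the components.
  classes : List (Subset N)
  classes = deduplicate (Vec.≡-dec Bool._≟_) (map (class F) (filter (_∈? V F) (allFin N)))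

  component : Fin (length classes) → Graph N
  component i = F [ lookup classes i ]

  component-∈ : ∀ i → component i ∈ components F
  component-∈ i = ∈-map⁺ (F [_]) (∈-lookup i)

  -- The index is the position of `class F x` in the list. Uniqueness holds because classes that
  -- share a vertex are equal and the list has no duplicates.
  components-partition : ∀ {x} → x Subset.∈ V F →
    ∃ λ i → x Subset.∈ V (component i) × ∀ j → i ≢ j → x ∉ V (component j)
  components-partition {x} x∈F = i
    , x∈p∩q⁺ (x∈F , subst (x Subset.∈_) (lookup-index class∈) (∈class⁺ ε))
    , λ j i≢j x∈Cⱼ → i≢j (lookup-injective unique
        (trans (sym (lookup-index class∈)) (class-of j (proj₂ (x∈p∩q⁻ (V F) _ x∈Cⱼ)))))
    where
    class∈ : class F x ∈ classes
    class∈ = ∈-deduplicate⁺ (Vec.≡-dec Bool._≟_)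
      (∈-map⁺ (class F) (∈-filter⁺ (_∈? V F) (∈-allFin x) x∈F))

    i = index class∈

    unique : Unique classes
    unique = Unique.deduplicate-! (Vec.≡-dec Bool._≟_) _

    class-of : ∀ j → x Subset.∈ lookup classes j → class F x ≡ lookup classes j
    -- A listed set is the class of some `z`; if it contains `x`, then `z` is connected to `x` and
    -- the two classes agree.
    class-of j x∈ with ∈-map⁻ (class F) (∈-deduplicate⁻ (Vec.≡-dec Bool._≟_)
      (map (class F) (filter (_∈? V F) (allFin N))) (∈-lookup j))
    ... | z , _ , eq = trans (sym (class-cong (∈class⁻ (subst (x Subset.∈_) eq x∈)))) (sym eq)

-- From a vertex partition to the theorem

allFractionalFactorsExcluding-partition : ∀ {m} → m ≥ 2 → (H G : Graph N) (g f : Vertex G → ℤ⁺) →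
  (X : Fin m → Subset N) →
  (∀ {x} → x Subset.∈ V G → ∃ λ i → x Subset.∈ X i × ∀ j → i ≢ j → x ∉ X j) →
  (∀ i → AllFractionalFactorsExcluding H (G ∖ X i) (restrict G (V G ─ X i) g) (restrict G (V G ─ X i) f)) →
  AllFractionalFactorsExcluding H G g f
-- Matching on `m ≥ 2` exposes the form `2 + k` that `Average` requires.
allFractionalFactorsExcluding-partition (s≤s (s≤s _)) H G g f X partition all r g≤r≤f =
  factor-average , λ x y (xy∈H , xy∈h) → factorAdj-average xy∈h
    λ (i , xy∈hᵢ) → proj₂ (factors i) x y (xy∈H , xy∈hᵢ)
  where
  -- One `r` serves all the graphs: its restriction to each `G ∖ X i` still lies between the
  -- restricted bounds.
  factors = λ i → all i (restrict G (V G ─ X i) r) (g≤r≤f ∘ refine (p∩q⊆p (V G) (V G ─ X i)))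
  open Average G X partition r (proj₁ ∘ factors)

theorem6 : ∀ {N : ℕ} (G F : Graph N) → IsCompleteFactor F G → ω F ≥ 2 →
    (g f : Vertex G → ℤ⁺) → (∀ x → g x ≤⁺ f x) →
    (H : Graph N) → H ⊑ G →
    (∀ C → C ∈ components F →
    AllFractionalFactorsExcluding H (G ∖ V C) (restrict G (V G ─ V C) g) (restrict G (V G ─ V C) f)) →
    AllFractionalFactorsExcluding H G g f
theorem6 G F F-factor ω≥2 g f _ H _ all = allFractionalFactorsExcluding-partition
  (subst (_≥ 2) (length-map (F [_]) (classes F)) ω≥2) H G g f (V ∘ component F)
  -- As `F` spans `G`, the partition of `V F` is one of `V G`.
  (components-partition F ∘ subst (_ Subset.∈_) (sym (IsCompleteFactor.spanning F-factor)))
  (λ i → all (component F i) (component-∈ F i))
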